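{- Let $G(r,c)$, $r,c\in\mathbb N$, be the table of Sprague-Grundy values of the single-quadrant queen game on $\mathbb N\times\mathbb N$ numbered along upward antidiagonals. Then every column and every row of the table is a permutation of $\mathbb N$; that is, for each $c\ge0$ the map $r\mapsto G(r,c)$ is a bijection $\mathbb N\to\mathbb N$, and for each $r\ge0$ the map $c\mapsto G(r,c)$ is a bijection $\mathbb N\to\mathbb N$.
   Context: $\mathbb N=\{0,1,2,\ldots\}$. The cell in row $r$ and column $c$ (rows numbered downward, columns numbered rightward, both from $0$) of the board $\mathbb N\times\mathbb N$ is $(r,c)$. The cells are numbered $0,1,2,\ldots$ along successive upward antidiagonals: $(0,0),(1,0),(0,1),(2,0),(1,1),(0,2),(3,0),\ldots$, so cell $(r,c)$ has number $\frac{(r+c)(r+c+1)}2+c$. In the game, a queen is placed on a cell and two players alternately move it to a lower-numbered cell that is a queen's move away (same row, same column, or same diagonal or antidiagonal, any distance); the first player unable to move loses. The Sprague-Grundy value $G(r,c)$ is the mex (smallest nonnegative integer not in the set) of the values $G(r',c')$ over all cells $(r',c')$ to which there is a legal move from $(r,c)$. -}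

module Defs where

open import Data.List.Base using (List; map; filter; upTo; cartesianProduct; sum)
open import Data.List.Membership.Propositional using (_∈_; _∉_)
open import Data.List.Membership.Propositional.Properties
  using (∈-map⁺; ∈-map⁻; ∈-filter⁺; ∈-filter⁻; ∈-upTo⁺; ∈-cartesianProduct⁺)
open import Data.List.Membership.DecPropositional using (_∈?_)
open import Data.List.Properties using (map-cong-local)
open import Data.List.Relation.Unary.All as All using (All)
open import Data.List.Relation.Unary.Any using (here; there)
open import Data.Nat
open import Data.Nat.Divisibility using (n∣m*n)
open import Data.Nat.DivMod using (/-monoˡ-≤; +-distrib-/-∣ʳ; m*n/n≡m)
open import Data.Nat.Induction using (<-rec)
open import Data.Nat.Properties
open import Data.Nat.Tactic.RingSolver using (solve-∀)
open import Data.Product using (∃-syntax; _×_; _,_; proj₁; proj₂; uncurry)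
open import Data.Sum using (_⊎_)
open import Relation.Binary.PropositionalEquality
open import Relation.Nullary using (¬_; Dec; yes; no)
open import Relation.Nullary.Decidable using (_×-dec_; _⊎-dec_; ¬?; map′)
open import Relation.Unary using (Decidable)

Cell : Set
Cell = ℕ × ℕ

number : Cell → ℕ
number (r , c) = ((r + c) * (r + c + 1)) / 2 + c

-- Row, column, diagonal (r - c constant, written without subtraction)
-- and antidiagonal, in this order.
QueenAligned : Cell → Cell → Set
QueenAligned (r , c) (r′ , c′) =
  r ≡ r′ ⊎ c ≡ c′ ⊎ r + c′ ≡ r′ + c ⊎ r + c ≡ r′ + c′

-- The strict inequality excludes staying on the same cell.
Move : Cell → Cell → Set
Move p q = number q < number p × QueenAligned p q

IsMex : (ℕ → Set) → ℕ → Set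
IsMex P m = ¬ P m × (∀ k → ¬ P k → m ≤ k)

OptionValue : (ℕ → ℕ → ℕ) → Cell → ℕ → Set
OptionValue G p v = ∃[ r′ ] ∃[ c′ ] Move p (r′ , c′) × G r′ c′ ≡ v

IsSpragueGrundy : (ℕ → ℕ → ℕ) → Set
IsSpragueGrundy G = ∀ r c → IsMex (OptionValue G (r , c)) (G r c)

-- The rest shows that a function satisfying IsSpragueGrundy exists and
-- is unique up to pointwise equality.

move? : ∀ p q → Dec (Move p q)
move? p@(r , c) q@(r′ , c′) =
  (number q <? number p) ×-dec
  ((r ≟ r′) ⊎-dec (c ≟ c′) ⊎-dec (r + c′ ≟ r′ + c) ⊎-dec (r + c ≟ r′ + c′))

private
  tri : ℕ → ℕ
  tri n = (n * (n + 1)) / 2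

  tri-suc : ∀ n → tri (suc n) ≡ tri n + suc n
  tri-suc n = begin
    (suc n * (suc n + 1)) / 2            ≡⟨ cong (_/ 2) (expand n) ⟩
    (n * (n + 1) + suc n * 2) / 2        ≡⟨ +-distrib-/-∣ʳ (n * (n + 1)) (n∣m*n (suc n)) ⟩
    tri n + (suc n * 2) / 2              ≡⟨ cong (tri n +_) (m*n/n≡m (suc n) 2) ⟩
    tri n + suc n                        ∎
    where
    open ≡-Reasoning
    expand : ∀ n → suc n * (suc n + 1) ≡ n * (n + 1) + suc n * 2
    expand = solve-∀

  tri-mono : ∀ {m n} → m ≤ n → tri m ≤ tri n
  tri-mono m≤n = /-monoˡ-≤ 2 (*-mono-≤ m≤n (+-monoˡ-≤ 1 m≤n))

number-< : ∀ r c r′ c′ → r + c < r′ + c′ → number (r , c) < number (r′ , c′)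
number-< r c r′ c′ lt = begin-strict
  tri (r + c) + c              ≤⟨ +-monoʳ-≤ (tri (r + c)) (m≤n+m c r) ⟩
  tri (r + c) + (r + c)        <⟨ +-monoʳ-< (tri (r + c)) (n<1+n (r + c)) ⟩
  tri (r + c) + suc (r + c)    ≡⟨ tri-suc (r + c) ⟨
  tri (suc (r + c))            ≤⟨ tri-mono lt ⟩
  tri (r′ + c′)                ≤⟨ m≤m+n (tri (r′ + c′)) c′ ⟩
  tri (r′ + c′) + c′           ∎
  where open ≤-Reasoning

moves : Cell → List Cell
moves p@(r , c) =
  filter (move? p) (cartesianProduct (upTo (suc (r + c))) (upTo (suc (r + c))))

moves-complete : ∀ {p q} → Move p q → q ∈ moves p
moves-complete {p@(r , c)} {q@(r′ , c′)} mv@(lt , _) =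
  ∈-filter⁺ (move? p)
    (∈-cartesianProduct⁺ (∈-upTo⁺ (s≤s (≤-trans (m≤m+n r′ c′) bound)))
                         (∈-upTo⁺ (s≤s (≤-trans (m≤n+m c′ r′) bound))))
    mv
  where
  bound : r′ + c′ ≤ r + c
  bound = ≮⇒≥ λ gt → <-asym lt (number-< r c r′ c′ gt)

moves-sound : ∀ {p q} → q ∈ moves p → Move p q
moves-sound {p@(r , c)} q∈ =
  proj₂ (∈-filter⁻ (move? p)
    {xs = cartesianProduct (upTo (suc (r + c))) (upTo (suc (r + c)))} q∈)

optionValue? : ∀ G p → Decidable (OptionValue G p)
optionValue? G p v = map′ to from (_∈?_ _≟_ v (map (uncurry G) (moves p)))
  where
  to : v ∈ map (uncurry G) (moves p) → OptionValue G p v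
  to v∈ with ∈-map⁻ (uncurry G) v∈
  ... | (r′ , c′) , q∈ , eq = r′ , c′ , moves-sound q∈ , sym eq
  from : OptionValue G p v → v ∈ map (uncurry G) (moves p)
  from (_ , _ , mv , refl) = ∈-map⁺ (uncurry G) (moves-complete mv)

private
  least : ∀ {P : ℕ → Set} → Decidable P → ∀ n → P n →
          ∃[ m ] P m × (∀ k → P k → m ≤ k)
  least {P} P? = <-rec _ step
    where
    step : ∀ n → (∀ {k} → k < n → P k → ∃[ m ] P m × (∀ j → P j → m ≤ j)) →
           P n → ∃[ m ] P m × (∀ k → P k → m ≤ k)
    step n rec pn with anyUpTo? P? n
    ... | yes (k , k<n , pk) = rec k<n pk
    ... | no none = n , pn , λ k pk → ≮⇒≥ λ k<n → none (k , k<n , pk)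

  ∈⇒≤sum : ∀ {v xs} → v ∈ xs → v ≤ sum xs
  ∈⇒≤sum (here refl) = m≤m+n _ _
  ∈⇒≤sum (there v∈) = ≤-trans (∈⇒≤sum v∈) (m≤n+m _ _)

  leastOutside : ∀ xs → ∃[ m ] m ∉ xs × (∀ k → k ∉ xs → m ≤ k)
  leastOutside xs = least (λ k → ¬? (_∈?_ _≟_ k xs)) (suc (sum xs))
                          (λ v∈ → <-irrefl refl (∈⇒≤sum v∈))

mex : List ℕ → ℕ
mex xs = proj₁ (leastOutside xs)

private
  -- The first argument is fuel; it is enough once it exceeds the cell number.
  value : ℕ → Cell → ℕ
  value zero    p = 0
  value (suc n) p = mex (map (value n) (moves p))

  value-fuel : ∀ m n p → number p < m → number p < n → value m p ≡ value n p
  value-fuel (suc m) (suc n) p (s≤s p≤m) (s≤s p≤n) =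
    cong mex (map-cong-local (All.tabulate {xs = moves p} λ {q} q∈ →
      let q<p = proj₁ (moves-sound {p} q∈) in
      value-fuel m n q (<-≤-trans q<p p≤m) (<-≤-trans q<p p≤n)))

spragueGrundy : ℕ → ℕ → ℕ
spragueGrundy r c = value (suc (number (r , c))) (r , c)

spragueGrundy-correct : IsSpragueGrundy spragueGrundy
spragueGrundy-correct r c = notOption , minimal
  where
  p : Cell
  p = r , c

  opts : List ℕ
  opts = map (value (number p)) (moves p)

  agree : ∀ {r′ c′} → Move p (r′ , c′) →
          spragueGrundy r′ c′ ≡ value (number p) (r′ , c′)
  agree (lt , _) = value-fuel _ _ _ ≤-refl lt

  to : ∀ {v} → OptionValue spragueGrundy p v → v ∈ opts
  to (_ , _ , mv , refl) =
    subst (_∈ opts) (sym (agree mv)) (∈-map⁺ (value (number p)) (moves-complete mv))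

  from : ∀ {v} → v ∈ opts → OptionValue spragueGrundy p v
  from v∈ with ∈-map⁻ (value (number p)) v∈
  ... | (r′ , c′) , q∈ , eq =
    let mv = moves-sound q∈ in r′ , c′ , mv , trans (agree mv) (sym eq)

  notOption : ¬ OptionValue spragueGrundy p (spragueGrundy r c)
  notOption o = proj₁ (proj₂ (leastOutside opts)) (to o)

  minimal : ∀ k → ¬ OptionValue spragueGrundy p k → spragueGrundy r c ≤ k
  minimal k ¬o = proj₂ (proj₂ (leastOutside opts)) k (λ k∈ → ¬o (from k∈))

spragueGrundy-unique : ∀ {G H} → IsSpragueGrundy G → IsSpragueGrundy H →
                       ∀ r c → G r c ≡ H r c
spragueGrundy-unique {G} {H} isG isH r c = go _ r c ≤-refl
  where
  go : ∀ n r c → number (r , c) < n → G r c ≡ H r c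
  go (suc n) r c (s≤s p≤n) = ≤-antisym
    (proj₂ (isG r c) (H r c) λ (r′ , c′ , mv , eq) →
      proj₁ (isH r c) (r′ , c′ , mv , trans (sym (ih mv)) eq))
    (proj₂ (isH r c) (G r c) λ (r′ , c′ , mv , eq) →
      proj₁ (isG r c) (r′ , c′ , mv , trans (ih mv) eq))
    where
    ih : ∀ {r′ c′} → Move (r , c) (r′ , c′) → G r′ c′ ≡ H r′ c′
    ih (lt , _) = go n _ _ (<-≤-trans lt p≤n)

{-# OPTIONS --safe #-}
module Submission where

-- Two aligned cells are joined by a move in one direction, so their values
-- differ; hence every row and every column is injective.
--
-- For surjectivity, fix a line (row or column) and a value v.  By induction
-- the line contains all values below v, and v occurs in every column to the
-- left of the given column (respectively in every row above the given row).
-- Far out on the line, therefore, the values are at least v, so by the mex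
-- property a cell there either has the value v or has an option of value v.
--
-- Column c.  An option outside the column lies further left, because within
-- an antidiagonal only moves to the left decrease the number.  Occurrences of
-- v to the left of column c are finite in number, and a cell far enough down
-- the column is aligned with none of them.  So v occurs in the column
-- (column-step).
--
-- Row r.  Options outside the row lie in an earlier row, where finiteness
-- disposes of them in the same way, or on the same antidiagonal, below the
-- row.  So if v were missing from the row, then v would occur on every
-- antidiagonal from some index on.  The k occurrences on the antidiagonals
-- A, ..., A + k - 1 lie in distinct rows and in distinct columns, so the sum
-- of their coordinates is at least 2(0 + 1 + ... + (k - 1)); but it equals
-- kA + (0 + 1 + ... + (k - 1)).  This fails as soon as k exceeds 2A + 1
-- (no-rooks-on-successive-antidiagonals).

open import Defs
open import Data.Fin.Base as Fin using (Fin; toℕ; fromℕ<)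
open import Data.Fin.Properties
  using (any?; toℕ-injective; fromℕ<-injective; injective⇒≤; punchIn-injective)
open import Data.Nat
open import Data.Nat.Induction using (<-rec)
open import Data.Nat.Properties
open import Data.Nat.Tactic.RingSolver using (solve-∀)
open import Data.Product using (∃-syntax; _×_; _,_; proj₁; proj₂)
open import Data.Sum using (_⊎_; inj₁; inj₂)
open import Data.Vec.Functional using (removeAt)
open import Function.Base using (_∘_)
open import Function.Consequences.Propositional using (strictlySurjective⇒surjective)
open import Function.Definitions using (Bijective; Injective)
open import Relation.Binary.Definitions using (tri<; tri≈; tri>)
open import Relation.Binary.PropositionalEquality
open import Relation.Nullary using (¬_; yes; no; contradiction)
open import Algebra.Properties.CommutativeMonoid.Sum +-0-commutativeMonoid
  using (sum; sum-remove; ∑-distrib-+; sum-cong-≗)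

-- Sums of distinct natural numbers

sum-const : ∀ k a → sum {k} (λ _ → a) ≡ k * a
sum-const zero    a = refl
sum-const (suc k) a = cong (a +_) (sum-const k a)

-- 0 + 1 + ... + (k - 1).
triangle : ℕ → ℕ
triangle k = sum {k} toℕ

triangle-suc : ∀ k → triangle (suc k) ≡ k + triangle k
triangle-suc k = begin
  sum {k} (λ i → 1 + toℕ i)            ≡⟨ ∑-distrib-+ {k} (λ _ → 1) toℕ ⟩
  sum {k} (λ _ → 1) + triangle k       ≡⟨ cong (_+ triangle k) (sum-const k 1) ⟩
  k * 1 + triangle k                   ≡⟨ cong (_+ triangle k) (*-identityʳ k) ⟩
  k + triangle k                       ∎
  where open ≡-Reasoning

triangle-double : ∀ k → triangle k + triangle k + k ≡ k * k
triangle-double zero    = refl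
triangle-double (suc k) = begin
  triangle (suc k) + triangle (suc k) + suc k       ≡⟨ cong (λ t → t + t + suc k) (triangle-suc k) ⟩
  (k + triangle k) + (k + triangle k) + suc k       ≡⟨ regroup k (triangle k) ⟩
  (triangle k + triangle k + k) + (suc k + k)       ≡⟨ cong (_+ (suc k + k)) (triangle-double k) ⟩
  k * k + (suc k + k)                               ≡⟨ square k ⟩
  suc k * suc k                                     ∎
  where
  open ≡-Reasoning
  regroup : ∀ k t → (k + t) + (k + t) + suc k ≡ (t + t + k) + (suc k + k)
  regroup = solve-∀
  square : ∀ k → k * k + (suc k + k) ≡ suc k * suc k
  square = solve-∀

injective⇒large-value : ∀ {k} (f : Fin (suc k) → ℕ) → Injective _≡_ _≡_ f →
                        ∃[ i ] k ≤ f i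
injective⇒large-value {k} f inj with any? (λ i → k ≤? f i)
... | yes large = large
... | no  none  = contradiction (injective⇒≤ below-injective) 1+n≰n
  where
  below : ∀ i → f i < k
  below i = ≰⇒> λ k≤fi → none (i , k≤fi)

  below-injective : Injective _≡_ _≡_ (λ i → fromℕ< (below i))
  below-injective {i} {j} eq = inj (fromℕ<-injective _ _ (below i) (below j) eq)

-- Remove an entry that is at least k - 1 and recurse.
triangle≤sum : ∀ {k} (f : Fin k → ℕ) → Injective _≡_ _≡_ f → triangle k ≤ sum f
triangle≤sum {zero}  f inj = z≤n
triangle≤sum {suc k} f inj with injective⇒large-value f inj
... | i , k≤fi = begin
  triangle (suc k)           ≡⟨ triangle-suc k ⟩
  k + triangle k             ≤⟨ +-mono-≤ k≤fi (triangle≤sum (removeAt f i) rest-injective) ⟩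
  f i + sum (removeAt f i)   ≡⟨ sum-remove f ⟨
  sum f                      ∎
  where
  open ≤-Reasoning
  rest-injective : Injective _≡_ _≡_ (removeAt f i)
  rest-injective {j} {l} eq = punchIn-injective i j l (inj eq)

-- Row ρ i and column γ i hold the rook on the antidiagonal A + i.
no-rooks-on-successive-antidiagonals :
  ∀ A (ρ γ : Fin (2 + 2 * A) → ℕ) → Injective _≡_ _≡_ ρ → Injective _≡_ _≡_ γ →
  ¬ (∀ i → ρ i + γ i ≡ A + toℕ i)
no-rooks-on-successive-antidiagonals A ρ γ ρ-inj γ-inj on-antidiagonal =
  <-irrefl refl (begin-strict
    k * k                          ≡⟨ triangle-double k ⟨
    T + T + k                      ≤⟨ +-monoˡ-≤ k (+-mono-≤ T≤kA T≤kA) ⟩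
    k * A + k * A + k              <⟨ m<m+n (k * A + k * A + k) z<s ⟩
    k * A + k * A + k + k          ≡⟨ expand A ⟩
    k * k                          ∎)
  where
  open ≤-Reasoning
  k = 2 + 2 * A
  T = triangle k

  T≤kA : T ≤ k * A
  T≤kA = +-cancelʳ-≤ T T (k * A) (begin
    T + T                                   ≤⟨ +-mono-≤ (triangle≤sum ρ ρ-inj) (triangle≤sum γ γ-inj) ⟩
    sum ρ + sum γ                           ≡⟨ ∑-distrib-+ ρ γ ⟨
    sum (λ i → ρ i + γ i)                   ≡⟨ sum-cong-≗ on-antidiagonal ⟩
    sum {k} (λ i → A + toℕ i)               ≡⟨ ∑-distrib-+ {k} (λ _ → A) toℕ ⟩
    sum {k} (λ _ → A) + T                   ≡⟨ cong (_+ T) (sum-const k A) ⟩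
    k * A + T                               ∎)

  expand : ∀ A → (2 + 2 * A) * A + (2 + 2 * A) * A + (2 + 2 * A) + (2 + 2 * A)
               ≡ (2 + 2 * A) * (2 + 2 * A)
  expand = solve-∀

-- Finite search and finite bounds

left-or-all-right : ∀ {n} {A : Set} {B : Fin n → Set} →
                    (∀ i → A ⊎ B i) → A ⊎ (∀ i → B i)
left-or-all-right {zero}  f = inj₂ λ ()
left-or-all-right {suc n} f with f Fin.zero | left-or-all-right (f ∘ Fin.suc)
... | inj₁ a | _       = inj₁ a
... | inj₂ _ | inj₁ a  = inj₁ a
... | inj₂ b | inj₂ bs = inj₂ λ { Fin.zero → b ; (Fin.suc i) → bs i }

-- Uniqueness alone would not give a bound constructively: it is computed from
-- the given witnesses.
unique-witnesses-bounded :
  ∀ (P : ℕ → ℕ → Set) → (∀ {u x y} → P u x → P u y → x ≡ y) →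
  ∀ m → (∀ {u} → u < m → ∃[ x ] P u x) →
  ∃[ N ] (∀ {u x} → u < m → P u x → x < N)
unique-witnesses-bounded P unique zero    witness = 0 , λ ()
unique-witnesses-bounded P unique (suc m) witness
  with unique-witnesses-bounded P unique m (witness ∘ m<n⇒m<1+n) | witness (n<1+n m)
... | N , bound | x₀ , px₀ = suc x₀ + N , extended
  where
  extended : ∀ {u x} → u < suc m → P u x → x < suc x₀ + N
  extended u<1+m px with m<1+n⇒m<n∨m≡n u<1+m
  ... | inj₁ u<m  = <-≤-trans (bound u<m px) (m≤n+m N (suc x₀))
  ... | inj₂ refl = s≤s (≤-trans (≤-reflexive (unique px px₀)) (m≤m+n x₀ N))

-- Geometry of the moves

number-<⇒antidiagonal-≤ : ∀ r c r′ c′ → number (r′ , c′) < number (r , c) →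
                          r′ + c′ ≤ r + c
number-<⇒antidiagonal-≤ r c r′ c′ lt =
  ≮⇒≥ λ gt → <-asym lt (number-< r c r′ c′ gt)

same-antidiagonal⇒left : ∀ {r c r′ c′} → r + c ≡ r′ + c′ →
                         number (r′ , c′) < number (r , c) → c′ < c
same-antidiagonal⇒left {r} {c} {r′} {c′} eq lt =
  +-cancelˡ-< (((r + c) * (r + c + 1)) / 2) c′ c
    (subst (λ s → (s * (s + 1)) / 2 + c′ < number (r , c)) (sym eq) lt)

number-injective : ∀ {p q} → number p ≡ number q → p ≡ q
number-injective {r , c} {r′ , c′} eq with <-cmp (r + c) (r′ + c′)
... | tri< lt _ _ = contradiction eq (<⇒≢ (number-< r c r′ c′ lt))
... | tri> _ _ gt = contradiction (sym eq) (<⇒≢ (number-< r′ c′ r c gt))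
... | tri≈ _ same _ = cong₂ _,_ r≡r′ c≡c′
  where
  c≡c′ : c ≡ c′
  c≡c′ = +-cancelˡ-≡ (((r + c) * (r + c + 1)) / 2) c c′
    (trans eq (cong (λ s → (s * (s + 1)) / 2 + c′) (sym same)))

  r≡r′ : r ≡ r′
  r≡r′ = +-cancelʳ-≡ c r r′ (trans same (cong (r′ +_) (sym c≡c′)))

aligned-sym : ∀ {p q} → QueenAligned p q → QueenAligned q p
aligned-sym (inj₁ row)                       = inj₁ (sym row)
aligned-sym (inj₂ (inj₁ column))             = inj₂ (inj₁ (sym column))
aligned-sym (inj₂ (inj₂ (inj₁ diagonal)))     = inj₂ (inj₂ (inj₁ (sym diagonal)))
aligned-sym (inj₂ (inj₂ (inj₂ antidiagonal))) = inj₂ (inj₂ (inj₂ (sym antidiagonal)))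

move-along-diagonal⇒up : ∀ {r c r′ c′} → r + c′ ≡ r′ + c →
                         number (r′ , c′) < number (r , c) → r′ < r
move-along-diagonal⇒up {r} {c} {r′} {c′} diagonal lt = ≰⇒> λ r≤r′ →
  let c≤c′ : c ≤ c′
      c≤c′ = +-cancelˡ-≤ r c c′
        (≤-trans (+-monoˡ-≤ c r≤r′) (≤-reflexive (sym diagonal)))
      r≡r′ : r ≡ r′
      r≡r′ = ≤-antisym r≤r′ (+-cancelʳ-≤ c r′ r
        (≤-trans (+-monoʳ-≤ r′ c≤c′) (number-<⇒antidiagonal-≤ r c r′ c′ lt)))
      c≡c′ : c ≡ c′
      c≡c′ = sym (+-cancelˡ-≡ r c′ c (trans diagonal (cong (_+ c) (sym r≡r′))))
  in <⇒≢ lt (sym (cong₂ (λ x y → number (x , y)) r≡r′ c≡c′))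

move⇒same-column-or-left : ∀ {r c r′ c′} → Move (r , c) (r′ , c′) → c ≡ c′ ⊎ c′ < c
move⇒same-column-or-left {r} {c} {r′} {c′} (lt , inj₁ refl) =
  inj₂ (≤∧≢⇒< (+-cancelˡ-≤ r c′ c (number-<⇒antidiagonal-≤ r c r′ c′ lt)) λ { refl → <-irrefl refl lt })
move⇒same-column-or-left (lt , inj₂ (inj₁ column)) = inj₁ column
move⇒same-column-or-left {r} {c} {r′} {c′} (lt , inj₂ (inj₂ (inj₁ diagonal))) =
  inj₂ (≰⇒> λ c≤c′ → <-irrefl (sym diagonal)
    (<-≤-trans (+-monoˡ-< c (move-along-diagonal⇒up diagonal lt)) (+-monoʳ-≤ r c≤c′)))
move⇒same-column-or-left (lt , inj₂ (inj₂ (inj₂ antidiagonal))) =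
  inj₂ (same-antidiagonal⇒left antidiagonal lt)

move⇒same-row-or-up-or-antidiagonal :
  ∀ {r c r′ c′} → Move (r , c) (r′ , c′) → r ≡ r′ ⊎ r′ < r ⊎ r + c ≡ r′ + c′
move⇒same-row-or-up-or-antidiagonal (lt , inj₁ row) = inj₁ row
move⇒same-row-or-up-or-antidiagonal {r} {c} {r′} {c′} (lt , inj₂ (inj₁ refl)) =
  inj₂ (inj₁ (≤∧≢⇒< (+-cancelʳ-≤ c r′ r (number-<⇒antidiagonal-≤ r c r′ c′ lt))
                    λ { refl → <-irrefl refl lt }))
move⇒same-row-or-up-or-antidiagonal {r} {c} {r′} {c′} (lt , inj₂ (inj₂ (inj₁ diagonal))) =
  inj₂ (inj₁ (move-along-diagonal⇒up {r} {c} {r′} {c′} diagonal lt))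
move⇒same-row-or-up-or-antidiagonal (lt , inj₂ (inj₂ (inj₂ antidiagonal))) =
  inj₂ (inj₂ antidiagonal)

far-below⇒¬aligned : ∀ {N r c r′ c′} → N + c ≤ r → r′ < N → c′ < c →
                     ¬ QueenAligned (r , c) (r′ , c′)
far-below⇒¬aligned {N} {r} {c} {r′} {c′} N+c≤r r′<N c′<c = λ where
    (inj₁ refl)                       → <-irrefl refl (<-≤-trans r′<N N≤r)
    (inj₂ (inj₁ refl))                → <-irrefl refl c′<c
    (inj₂ (inj₂ (inj₁ diagonal)))     → <-irrefl (sym diagonal)
      (<-≤-trans (+-monoˡ-< c r′<N) (≤-trans N+c≤r (m≤m+n r c′)))
    (inj₂ (inj₂ (inj₂ antidiagonal))) → <-irrefl (sym antidiagonal)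
      (+-mono-< (<-≤-trans r′<N N≤r) c′<c)
  where
  N≤r : N ≤ r
  N≤r = ≤-trans (m≤m+n N c) N+c≤r

aligned-transpose : ∀ {r c r′ c′} → QueenAligned (r , c) (r′ , c′) →
                    QueenAligned (c , r) (c′ , r′)
aligned-transpose (inj₁ row)           = inj₂ (inj₁ row)
aligned-transpose (inj₂ (inj₁ column)) = inj₁ column
aligned-transpose {r} {c} {r′} {c′} (inj₂ (inj₂ (inj₁ diagonal))) =
  inj₂ (inj₂ (inj₁ (trans (+-comm c r′) (trans (sym diagonal) (+-comm r c′)))))
aligned-transpose {r} {c} {r′} {c′} (inj₂ (inj₂ (inj₂ antidiagonal))) =
  inj₂ (inj₂ (inj₂ (trans (+-comm c r) (trans antidiagonal (+-comm r′ c′)))))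

module _ {G : ℕ → ℕ → ℕ} (isG : IsSpragueGrundy G) where

  -- Injectivity

  aligned-same-value⇒≡ : ∀ {r c r′ c′} → QueenAligned (r , c) (r′ , c′) →
                          G r c ≡ G r′ c′ → (r , c) ≡ (r′ , c′)
  aligned-same-value⇒≡ {r} {c} {r′} {c′} al eq with <-cmp (number (r , c)) (number (r′ , c′))
  ... | tri< lt _ _   = contradiction (r , c , (lt , aligned-sym al) , eq) (proj₁ (isG r′ c′))
  ... | tri≈ _ same _ = number-injective same
  ... | tri> _ _ gt   = contradiction (r′ , c′ , (gt , al) , sym eq) (proj₁ (isG r c))

  column-injective : ∀ c → Injective _≡_ _≡_ (λ r → G r c)
  column-injective c eq = cong proj₁ (aligned-same-value⇒≡ (inj₂ (inj₁ refl)) eq)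

  row-injective : ∀ r → Injective _≡_ _≡_ (G r)
  row-injective r eq = cong proj₂ (aligned-same-value⇒≡ (inj₁ refl) eq)

  -- Surjectivity

  value-or-option : ∀ r c {v} → v ≤ G r c → G r c ≡ v ⊎ OptionValue G (r , c) v
  value-or-option r c {v} v≤ with optionValue? G (r , c) v
  ... | yes option   = inj₂ option
  ... | no  noOption = inj₁ (≤-antisym (proj₂ (isG r c) v noOption) v≤)

  column-step : ∀ c v → (∀ {c′} → c′ < c → ∃[ r ] G r c′ ≡ v) →
                (∀ {u} → u < v → ∃[ r ] G r c ≡ u) → ∃[ r ] G r c ≡ v
  column-step c v left smaller
    with unique-witnesses-bounded (λ u r → G r c ≡ u)
           (λ e e′ → column-injective c (trans e (sym e′))) v smaller
       | unique-witnesses-bounded (λ c′ r → G r c′ ≡ v)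
           (λ {c′} e e′ → column-injective c′ (trans e (sym e′))) c left
  ... | M , smaller<M | N , left<N = conclude (value-or-option R c v≤)
    where
    -- From row M on no value of the column is less than v; the further N + c
    -- rows escape the occurrences of v to the left.
    R : ℕ
    R = M + (N + c)

    v≤ : v ≤ G R c
    v≤ = ≮⇒≥ λ lt → <⇒≱ (smaller<M lt refl) (m≤m+n M (N + c))

    conclude : G R c ≡ v ⊎ OptionValue G (R , c) v → ∃[ r ] G r c ≡ v
    conclude (inj₁ hit) = R , hit
    conclude (inj₂ (r′ , c′ , mv , eq)) with move⇒same-column-or-left mv
    ... | inj₁ refl = r′ , eq
    ... | inj₂ c′<c = contradiction (proj₂ mv)
                        (far-below⇒¬aligned (m≤n+m (N + c) M) (left<N c′<c eq) c′<c)

  column-surjective : ∀ c v → ∃[ r ] G r c ≡ v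
  column-surjective = <-rec (λ c → ∀ v → ∃[ r ] G r c ≡ v) λ c left →
    <-rec (λ v → ∃[ r ] G r c ≡ v) λ v → column-step c v (λ c′<c → left c′<c v)

  row-step : ∀ r v → (∀ {r′} → r′ < r → ∃[ c ] G r′ c ≡ v) →
             (∀ {u} → u < v → ∃[ c ] G r c ≡ u) → ∃[ c ] G r c ≡ v
  row-step r v above smaller
    with unique-witnesses-bounded (λ u c → G r c ≡ u)
           (λ e e′ → row-injective r (trans e (sym e′))) v smaller
       | unique-witnesses-bounded (λ r′ c → G r′ c ≡ v)
           (λ {r′} e e′ → row-injective r′ (trans e (sym e′))) r above
  ... | M , smaller<M | N , above<N = conclude (left-or-all-right search)
    where
    -- From column M on no value of the row is less than v; the further N + r
    -- columns escape the occurrences of v above the row.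
    C : ℕ → ℕ
    C i = M + (N + r) + i

    M≤C : ∀ i → M ≤ C i
    M≤C i = ≤-trans (m≤m+n M (N + r)) (m≤m+n (M + (N + r)) i)

    N+r≤C : ∀ i → N + r ≤ C i
    N+r≤C i = ≤-trans (m≤n+m (N + r) M) (m≤m+n (M + (N + r)) i)

    v≤ : ∀ i → v ≤ G r (C i)
    v≤ i = ≮⇒≥ λ lt → <⇒≱ (smaller<M lt refl) (M≤C i)

    -- The index of the antidiagonal through (r , C 0).
    A : ℕ
    A = r + (M + (N + r))

    -- An occurrence of v on the antidiagonal A + i, that of (r , C i).
    Occurrence : ℕ → Set
    Occurrence i = ∃[ r′ ] ∃[ c′ ] r′ + c′ ≡ A + i × G r′ c′ ≡ v

    search : ∀ (i : Fin (2 + 2 * A)) → (∃[ c ] G r c ≡ v) ⊎ Occurrence (toℕ i)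
    search j with toℕ j
    ... | i with value-or-option r (C i) (v≤ i)
    ...   | inj₁ hit = inj₁ (C i , hit)
    ...   | inj₂ (r′ , c′ , mv , eq) with move⇒same-row-or-up-or-antidiagonal mv
    ...     | inj₁ refl        = inj₁ (c′ , eq)
    ...     | inj₂ (inj₁ r′<r) = contradiction (aligned-transpose (proj₂ mv))
                                   (far-below⇒¬aligned (N+r≤C i) (above<N r′<r eq) r′<r)
    ...     | inj₂ (inj₂ antidiagonal) =
      inj₂ (r′ , c′ , trans (sym antidiagonal) (sym (+-assoc r (M + (N + r)) i)) , eq)

    -- Two occurrences of v in one row or one column are the same cell, hence on
    -- the same antidiagonal.
    no-occurrences : ¬ (∀ (i : Fin (2 + 2 * A)) → Occurrence (toℕ i))
    no-occurrences occ =
      no-rooks-on-successive-antidiagonals A ρ γ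
        (λ {i} {j} eq → determined (aligned-same-value⇒≡ (inj₁ eq) (same-value i j)))
        (λ {i} {j} eq → determined (aligned-same-value⇒≡ (inj₂ (inj₁ eq)) (same-value i j)))
        on-antidiagonal
      where
      ρ γ : Fin (2 + 2 * A) → ℕ
      ρ i = proj₁ (occ i)
      γ i = proj₁ (proj₂ (occ i))

      on-antidiagonal : ∀ i → ρ i + γ i ≡ A + toℕ i
      on-antidiagonal i = proj₁ (proj₂ (proj₂ (occ i)))

      same-value : ∀ i j → G (ρ i) (γ i) ≡ G (ρ j) (γ j)
      same-value i j =
        trans (proj₂ (proj₂ (proj₂ (occ i)))) (sym (proj₂ (proj₂ (proj₂ (occ j)))))

      determined : ∀ {i j} → (ρ i , γ i) ≡ (ρ j , γ j) → i ≡ j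
      determined {i} {j} eq = toℕ-injective (+-cancelˡ-≡ A (toℕ i) (toℕ j)
        (trans (sym (on-antidiagonal i))
          (trans (cong (λ p → proj₁ p + proj₂ p) eq) (on-antidiagonal j))))

    conclude : (∃[ c ] G r c ≡ v) ⊎ (∀ i → Occurrence (toℕ i)) → ∃[ c ] G r c ≡ v
    conclude (inj₁ found) = found
    conclude (inj₂ occ)   = contradiction occ no-occurrences

  row-surjective : ∀ r v → ∃[ c ] G r c ≡ v
  row-surjective = <-rec (λ r → ∀ v → ∃[ c ] G r c ≡ v) λ r above →
    <-rec (λ v → ∃[ c ] G r c ≡ v) λ v → row-step r v (λ r′<r → above r′<r v)

theorem23 : (G : ℕ → ℕ → ℕ) → IsSpragueGrundy G →
    (∀ c → Bijective _≡_ _≡_ (λ r → G r c)) ×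
    (∀ r → Bijective _≡_ _≡_ (λ c → G r c))
theorem23 G isG =
  (λ c → column-injective isG c , strictlySurjective⇒surjective (column-surjective isG c)) ,
  (λ r → row-injective isG r , strictlySurjective⇒surjective (row-surjective isG r))
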